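{- Let $\{G_n^*(x)\}$ (of Lucas type) and $\{G_n'(x)\}$ (of Fibonacci type) be equivalent generalized Fibonacci polynomial sequences. If $m$ and $n$ are positive integers, then $$\gcd(G'_m(x),G^*_n(x))=\begin{cases} G^*_{\gcd(m,n)}(x) & \text{if } E_2(m)>E_2(n),\\ \gcd\big(G^*_{\gcd(m,n)}(x),G^*_0(x)\big) & \text{otherwise.}\end{cases}$$
   Context: All polynomials lie in $\mathbb{Z}[x]$ and $\gcd$ denotes the greatest common divisor in $\mathbb{Z}[x]$ (determined up to sign). A generalized Fibonacci polynomial (GFP) sequence $\{G_n(x)\}_{n\ge0}$ is given by $G_0(x)=p_0(x)$, $G_1(x)=p_1(x)$ and $G_n(x)=d(x)G_{n-1}(x)+g(x)G_{n-2}(x)$ for $n\ge 2$, where $p_0(x)$ is a constant and $p_1(x),d(x),g(x)$ are nonzero polynomials in $\mathbb{Z}[x]$ with $\gcd(d(x),g(x))=1$; as in the paper it is assumed that $d(x)^2+4g(x)>0$. Let $a,b$ be the roots of $z^2-d(x)z-g(x)=0$. The sequence is of Lucas type if $p_0\ne 0$, $2p_1(x)=p_0\,d(x)$, $|p_0|\in\{1,2\}$, and $\gcd(p_0,p_1(x))=\gcd(p_0,d(x))=\gcd(p_0,g(x))=1$; then, with $\alpha=2/p_0$, $G_n=(a^n+b^n)/\alpha$ (denoted $G_n^*$). It is of Fibonacci type if $p_0=0$ and $p_1=1$; then $G_n=(a^n-b^n)/(a-b)$ (denoted $G_n'$). A Lucas-type and a Fibonacci-type sequence are equivalent if they are defined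 with the same $d(x)$ and $g(x)$. For a positive integer $n$, $E_2(n)$ is the largest integer $k$ with $2^k\mid n$. -}

module Defs where

open import Data.Nat as ℕ using (ℕ; zero; suc)
open import Data.Nat.Divisibility as ℕD using ()
open import Data.Integer as ℤ using (ℤ; +_; 0ℤ; 1ℤ)
open import Data.List using (List; []; _∷_)
open import Data.Product using (Σ; ∃; _×_; _,_)
open import Data.Sum using (_⊎_)
open import Relation.Nullary using (¬_)
open import Relation.Binary.PropositionalEquality using (_≡_)

-- Polynomials in ℤ[x] as coefficient lists (lowest degree first).
-- Equality is coefficientwise (so trailing zeros are irrelevant).

Poly : Set
Poly = List ℤ

coeff : Poly → ℕ → ℤ
coeff []      _       = 0ℤ
coeff (a ∷ p) zero    = a
coeff (a ∷ p) (suc i) = coeff p i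

infix 4 _≈_
_≈_ : Poly → Poly → Set
p ≈ q = ∀ i → coeff p i ≡ coeff q i

const : ℤ → Poly
const c = c ∷ []

0P 1P : Poly
0P = []
1P = const 1ℤ

infixl 6 _+P_
_+P_ : Poly → Poly → Poly
[]      +P q       = q
(a ∷ p) +P []      = a ∷ p
(a ∷ p) +P (b ∷ q) = (a ℤ.+ b) ∷ (p +P q)

scale : ℤ → Poly → Poly
scale c []      = []
scale c (a ∷ p) = (c ℤ.* a) ∷ scale c p

infixl 7 _*P_
_*P_ : Poly → Poly → Poly
[]      *P q = []
(a ∷ p) *P q = scale a q +P (0ℤ ∷ (p *P q))

eval : Poly → ℤ → ℤ
eval []      x = 0ℤ
eval (a ∷ p) x = a ℤ.+ x ℤ.* eval p x

infix 4 _∣P_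
_∣P_ : Poly → Poly → Set
p ∣P q = ∃ λ (r : Poly) → q ≈ p *P r

IsGCD : Poly → Poly → Poly → Set
IsGCD h p q = (h ∣P p) × (h ∣P q) × (∀ e → e ∣P p → e ∣P q → e ∣P h)

CoprimeP : Poly → Poly → Set
CoprimeP p q = IsGCD 1P p q

NonZeroP : Poly → Set
NonZeroP p = ¬ (p ≈ 0P)

-- "d(x)^2 + 4 g(x) > 0": read as eventually positive (positive leading coefficient)
PositivePoly : Poly → Set
PositivePoly p = ∃ λ (N : ℤ) → ∀ (x : ℤ) → N ℤ.≤ x → 0ℤ ℤ.< eval p x

GFP : (p0 : ℤ) (p1 d g : Poly) → ℕ → Poly
GFP p0 p1 d g zero          = const p0
GFP p0 p1 d g (suc zero)    = p1
GFP p0 p1 d g (suc (suc n)) =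
  d *P GFP p0 p1 d g (suc n) +P g *P GFP p0 p1 d g n

GFPParams : Poly → Poly → Set
GFPParams d g =
  NonZeroP d × NonZeroP g × CoprimeP d g ×
  PositivePoly (d *P d +P scale (+ 4) g)

LucasType : ℤ → Poly → Poly → Poly → Set
LucasType p0 p1 d g =
  NonZeroP p1 ×
  ¬ (p0 ≡ 0ℤ) ×
  (scale (+ 2) p1 ≈ scale p0 d) ×
  (ℤ.∣ p0 ∣ ≡ 1 ⊎ ℤ.∣ p0 ∣ ≡ 2) ×
  CoprimeP (const p0) p1 × CoprimeP (const p0) d × CoprimeP (const p0) g

LucasSeq : ℤ → Poly → Poly → Poly → ℕ → Poly
LucasSeq p0 p1 d g = GFP p0 p1 d g

FibSeq : Poly → Poly → ℕ → Poly
FibSeq d g = GFP 0ℤ 1P d g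

IsE2 : ℕ → ℕ → Set
IsE2 n k = (2 ℕ.^ k) ℕD.∣ n × ¬ ((2 ℕ.^ suc k) ℕD.∣ n)

{-# OPTIONS --safe #-}

-- The heart of the matter is that Z[x] is a GCD domain: if p and q have only
-- units as common divisors and p divides q r, then p divides r. The Euclidean
-- algorithm, run on lowest coefficients, writes a product M of primes (integer
-- primes and x itself, all prime by Gauss's lemma) as u p + v q; so p divides
-- M r, and the primes of M can be cancelled one at a time.
--
-- Every G satisfying the recurrence obeys
--   G (n + m) = F m G (n + 1) + (F (m + 1) - d F m) G n,
-- and F m, F (m + 1) are coprime, so for a divisor e of F m the condition
-- e | G n depends only on n mod m. Applied to F and to the Lucas sequence L,
-- together with F (2 n) = (2 / p0) F n L n, this moves a common divisor of F m
-- and L n to F (2 r), where r = gcd (m, n), and even to F r if E2 m <= E2 n.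
-- Since n = r mod 2 r if E2 m > E2 n, and n = 0 mod r always, the divisor is
-- thereby moved from L n to L r, respectively to L 0.

module Submission where

open import Algebra.Bundles using (CommutativeRing)
import Algebra.Properties.CommutativeSemigroup as CommutativeSemigroupProperties
import Algebra.Properties.Ring as RingProperties
open import Data.Empty using (⊥-elim)
open import Data.Nat using (ℕ; zero; suc; _<_; _≤_; _>_)
import Data.Nat as ℕ
open import Data.Nat.Divisibility as ℕD using (divides)
open import Data.Nat.GCD using (gcd)
import Data.Nat.GCD as ℕG
import Data.Nat.Properties as ℕP
open import Data.Product using (∃; _×_; _,_; proj₁; proj₂)
open import Data.Sum as Sum using (_⊎_; inj₁; inj₂)
open import Level using (0ℓ; _⊔_)
open import Relation.Binary.PropositionalEquality as ≡ using (_≡_)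
import Relation.Binary.Reasoning.Setoid as SetoidReasoning
open import Relation.Nullary using (¬_; Dec; yes; no)

-- Divisibility in commutative rings

module Divisibility {c ℓ} (R : CommutativeRing c ℓ) where

  open CommutativeRing R
  open RingProperties ring using (+-cancelʳ)
  open SetoidReasoning setoid
  open import Algebra.Solver.Ring.NaturalCoefficients.Default commutativeSemiring using (solve; _:+_; _:*_; _:=_)

  infix 4 _∣_
  _∣_ : Carrier → Carrier → Set (c ⊔ ℓ)
  x ∣ y = ∃ λ r → y ≈ x * r

  Coprime : Carrier → Carrier → Set (c ⊔ ℓ)
  Coprime x y = ∀ z → z ∣ x → z ∣ y → z ∣ 1#

  IsGcd : Carrier → Carrier → Carrier → Set (c ⊔ ℓ)
  IsGcd z x y = (z ∣ x) × (z ∣ y) × (∀ e → e ∣ x → e ∣ y → e ∣ z)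

  ∣-refl : ∀ {x} → x ∣ x
  ∣-refl {x} = 1# , sym (*-identityʳ x)

  ∣-trans : ∀ {x y z} → x ∣ y → y ∣ z → x ∣ z
  ∣-trans {x} (r , y≈) (s , z≈) =
    r * s , trans z≈ (trans (*-congʳ y≈) (*-assoc x r s))

  ∣-respʳ : ∀ {x y z} → y ≈ z → x ∣ y → x ∣ z
  ∣-respʳ y≈z (r , y≈) = r , trans (sym y≈z) y≈

  ∣0 : ∀ x → x ∣ 0#
  ∣0 x = 0# , sym (zeroʳ x)

  ∣x⇒∣xy : ∀ {z x} y → z ∣ x → z ∣ x * y
  ∣x⇒∣xy y z∣x = ∣-trans z∣x (y , refl)

  ∣y⇒∣xy : ∀ {z y} x → z ∣ y → z ∣ x * y
  ∣y⇒∣xy x z∣y = ∣-respʳ (*-comm _ x) (∣x⇒∣xy x z∣y)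

  ∣-+ : ∀ {z x y} → z ∣ x → z ∣ y → z ∣ x + y
  ∣-+ {z} (r , x≈) (s , y≈) = r + s , trans (+-cong x≈ y≈) (sym (distribˡ z r s))

  ∣-+-cancelʳ : ∀ {z x y} → z ∣ x + y → z ∣ y → z ∣ x
  ∣-+-cancelʳ {z} {x} {y} (r , x+y≈) (s , y≈) = r + - s , +-cancelʳ y x _ (begin
    x + y                    ≈⟨ x+y≈ ⟩
    z * r                    ≈⟨ +-identityʳ (z * r) ⟨
    z * r + 0#               ≈⟨ +-congˡ (zeroʳ z) ⟨
    z * r + z * 0#           ≈⟨ +-congˡ (*-congˡ (-‿inverseˡ s)) ⟨
    z * r + z * (- s + s)    ≈⟨ lemma z r (- s) s ⟩
    z * (r + - s) + z * s    ≈⟨ +-congˡ y≈ ⟨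
    z * (r + - s) + y        ∎)
    where
    lemma : ∀ z r t s → z * r + z * (t + s) ≈ z * (r + t) + z * s
    lemma = solve 4 (λ z r t s → z :* r :+ z :* (t :+ s) := z :* (r :+ t) :+ z :* s) refl

  ∣-+-cancelˡ : ∀ {z x y} → z ∣ x + y → z ∣ x → z ∣ y
  ∣-+-cancelˡ {x = x} {y} z∣ = ∣-+-cancelʳ (∣-respʳ (+-comm x y) z∣)

  Coprime-∣ˡ : ∀ {w x y} → w ∣ x → Coprime x y → Coprime w y
  Coprime-∣ˡ w∣x cop z z∣w = cop z (∣-trans z∣w w∣x)

  Coprime-sym : ∀ {x y} → Coprime x y → Coprime y x
  Coprime-sym cop z z∣y z∣x = cop z z∣x z∣y

-- Prime elements and Euclid's lemma in integral domains.

module Domain {c ℓ} (R : CommutativeRing c ℓ) where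

  open CommutativeRing R
  open Divisibility R
  open RingProperties ring using (-‿distribʳ-*; x∙y⁻¹≈ε⇒x≈y)
  open CommutativeSemigroupProperties *-commutativeSemigroup using (x∙yz≈y∙xz; xy∙z≈y∙xz; xy∙z≈xz∙y; x∙yz≈yx∙z; interchange)
  open SetoidReasoning setoid
  open import Algebra.Solver.Ring.NaturalCoefficients.Default commutativeSemiring using (solve; _:+_; _:*_; _:=_)

  module EuclidLemma
    (≈0? : ∀ x → Dec (x ≈ 0#))
    (integral : ∀ x y → x * y ≈ 0# → x ≈ 0# ⊎ y ≈ 0#)
    where

    *-cancelˡ : ∀ {x} → ¬ x ≈ 0# → ∀ y z → x * y ≈ x * z → y ≈ z
    *-cancelˡ {x} x≉0 y z xy≈xz with integral x (y - z) (begin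
        x * (y - z)          ≈⟨ distribˡ x y (- z) ⟩
        x * y + x * - z      ≈⟨ +-cong xy≈xz (sym (-‿distribʳ-* x z)) ⟩
        x * z + - (x * z)    ≈⟨ -‿inverseʳ (x * z) ⟩
        0#                   ∎)
    ... | inj₁ x≈0   = ⊥-elim (x≉0 x≈0)
    ... | inj₂ y-z≈0 = x∙y⁻¹≈ε⇒x≈y y z y-z≈0

    -- Decidability of `π ∣ x` is part of the data because cancelling a prime of `N` branches on
    -- whether it divides `h`.
    record PrimeElement (π : Carrier) : Set (c ⊔ ℓ) where
      field
        nonzero : ¬ π ≈ 0#
        nonunit : ¬ π ∣ 1#
        _∣?     : ∀ x → Dec (π ∣ x)
        split   : ∀ x y → π ∣ x * y → π ∣ x ⊎ π ∣ y

    -- Any unit serves as the empty product, and `prime` carries an equation up to `≈`, so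
    -- factorisations need no normal form.
    data PrimeProduct : Carrier → Set (c ⊔ ℓ) where
      unit  : ∀ {u} → u ∣ 1# → PrimeProduct u
      prime : ∀ {x π y} → PrimeElement π → x ≈ π * y → PrimeProduct y → PrimeProduct x

    PrimeProduct-unit* : ∀ {u y} → u ∣ 1# → PrimeProduct y → PrimeProduct (u * y)
    PrimeProduct-unit* {u} {y} (r , 1≈ur) (unit (s , 1≈ys)) = unit (r * s , (begin
      1#                 ≈⟨ *-identityˡ 1# ⟨
      1# * 1#            ≈⟨ *-cong 1≈ur 1≈ys ⟩
      u * r * (y * s)    ≈⟨ interchange u r y s ⟩
      u * y * (r * s)    ∎))
    PrimeProduct-unit* {u} {y} u∣1 (prime {π = π} {z} pr y≈πz Z) =
      prime pr (trans (*-congˡ y≈πz) (x∙yz≈y∙xz u π z)) (PrimeProduct-unit* u∣1 Z)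

    PrimeProduct-* : ∀ {x y} → PrimeProduct x → PrimeProduct y → PrimeProduct (x * y)
    PrimeProduct-* (unit u∣1) Y = PrimeProduct-unit* u∣1 Y
    PrimeProduct-* {y = y} (prime pr x≈πz Z) Y =
      prime pr (trans (*-congʳ x≈πz) (*-assoc _ _ y)) (PrimeProduct-* Z Y)

    -- The outcome of the Euclidean algorithm on x and y when the coefficients
    -- that may be divided by are exactly the products of primes.
    record WeakBézout (x y : Carrier) : Set (c ⊔ ℓ) where
      constructor weakBézout
      field
        {h M N u v x′ y′} : Carrier
        M-product : PrimeProduct M
        N-product : PrimeProduct N
        combination : M * h ≈ u * x + v * y
        divides-x : N * x ≈ h * x′
        divides-y : N * y ≈ h * y′

    WeakBézout-sym : ∀ {x y} → WeakBézout x y → WeakBézout y x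
    WeakBézout-sym (weakBézout M N eq eqx eqy) = weakBézout M N (trans eq (+-comm _ _)) eqy eqx

    WeakBézout-0ʳ : ∀ x {y} → y ≈ 0# → WeakBézout x y
    WeakBézout-0ʳ x {y} y≈0 = weakBézout {h = x} {u = 1#} {v = 0#} {1#} {0#} (unit ∣-refl) (unit ∣-refl)
      (trans (sym (+-identityʳ _)) (+-congˡ (sym (zeroˡ y))))
      (*-comm 1# x)
      (trans (*-identityˡ y) (trans y≈0 (sym (zeroʳ x))))

    -- One Euclidean step, from `w` back to `x`. The first equation turns combinations of `w` and
    -- `y` into combinations of `x` and `y` at the price of a factor `π` in `M`; the second carries
    -- divisibility by `h` from `w` to `x` at the price of a factor `b` in `N`.
    WeakBézout-reduce : ∀ {π b a a′ w x y} → PrimeProduct π → PrimeProduct b →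
      π * w ≈ b * x + a′ * y → b * x ≈ π * w + a * y → WeakBézout w y → WeakBézout x y
    WeakBézout-reduce {π} {b} {a} {a′} {w} {x} {y} Π B πw≈ bx≈
      (weakBézout {h} {M} {N} {u} {v} {w′} {y′} M-product N-product eq eqw eqy) =
      weakBézout (PrimeProduct-* Π M-product) (PrimeProduct-* B N-product)
      (begin
        π * M * h                               ≈⟨ *-assoc π M h ⟩
        π * (M * h)                             ≈⟨ *-congˡ eq ⟩
        π * (u * w + v * y)                     ≈⟨ lemma₁ π u w v y ⟩
        u * (π * w) + π * v * y                 ≈⟨ +-congʳ (*-congˡ πw≈) ⟩
        u * (b * x + a′ * y) + π * v * y        ≈⟨ lemma₂ u b x a′ y π v ⟩
        u * b * x + (u * a′ + π * v) * y        ∎)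
      (begin
        b * N * x                        ≈⟨ xy∙z≈y∙xz b N x ⟩
        N * (b * x)                      ≈⟨ *-congˡ bx≈ ⟩
        N * (π * w + a * y)              ≈⟨ lemma₁ N π w a y ⟩
        π * (N * w) + N * a * y          ≈⟨ +-cong (*-congˡ eqw) (trans (xy∙z≈y∙xz N a y) (*-congˡ eqy)) ⟩
        π * (h * w′) + a * (h * y′)      ≈⟨ lemma₄ π h w′ a y′ ⟩
        h * (π * w′ + a * y′)            ∎)
      (trans (*-assoc b N y) (trans (*-congˡ eqy) (x∙yz≈y∙xz b h y′)))
      where
      lemma₁ : ∀ π u w v y → π * (u * w + v * y) ≈ u * (π * w) + π * v * y
      lemma₁ = solve 5 (λ π u w v y → π :* (u :* w :+ v :* y) := u :* (π :* w) :+ π :* v :* y) refl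
      lemma₂ : ∀ u b x a y π v → u * (b * x + a * y) + π * v * y ≈ u * b * x + (u * a + π * v) * y
      lemma₂ = solve 7 (λ u b x a y π v → u :* (b :* x :+ a :* y) :+ π :* v :* y := u :* b :* x :+ (u :* a :+ π :* v) :* y) refl
      lemma₄ : ∀ π h w a y → π * (h * w) + a * (h * y) ≈ h * (π * w + a * y)
      lemma₄ = solve 5 (λ π h w a y → π :* (h :* w) :+ a :* (h :* y) := h :* (π :* w :+ a :* y)) refl

    -- Every prime of N divides h or both cofactors, so it can be cancelled;
    -- what then remains of h divides both x and y.
    coprime⇒PrimeProduct : ∀ {x y h x′ y′ N} → Coprime x y → PrimeProduct N →
      N * x ≈ h * x′ → N * y ≈ h * y′ → PrimeProduct h
    coprime⇒PrimeProduct {h = h} cop (unit (r , 1≈ur)) eqx eqy =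
      unit (cop h (h∣ eqx) (h∣ eqy))
      where
      h∣ : ∀ {z z′} → _ * z ≈ h * z′ → h ∣ z
      h∣ {z} {z′} eq = z′ * r , (begin
        z              ≈⟨ *-identityˡ z ⟨
        1# * z         ≈⟨ *-congʳ 1≈ur ⟩
        _ * r * z      ≈⟨ xy∙z≈xz∙y _ r z ⟩
        _ * z * r      ≈⟨ *-congʳ eq ⟩
        h * z′ * r     ≈⟨ *-assoc h z′ r ⟩
        h * (z′ * r)   ∎)
    coprime⇒PrimeProduct {x} {y} {h} {x′} {y′} cop (prime {π = π} {N} pr N≈ N-product) eqx eqy with pr .PrimeElement._∣? h
    ... | yes (h₁ , h≈) = prime pr h≈ (coprime⇒PrimeProduct cop N-product (cancel eqx) (cancel eqy))
      where
      cancel : ∀ {z z′} → _ * z ≈ h * z′ → N * z ≈ h₁ * z′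
      cancel {z} {z′} eq = *-cancelˡ (pr .PrimeElement.nonzero) (N * z) (h₁ * z′) (begin
        π * (N * z)     ≈⟨ *-assoc π N z ⟨
        π * N * z       ≈⟨ *-congʳ N≈ ⟨
        _ * z           ≈⟨ eq ⟩
        h * z′          ≈⟨ *-congʳ h≈ ⟩
        π * h₁ * z′     ≈⟨ *-assoc π h₁ z′ ⟩
        π * (h₁ * z′)   ∎)
    ... | no π∤h = coprime⇒PrimeProduct cop N-product (proj₂ (cancel eqx)) (proj₂ (cancel eqy))
      where
      cancel : ∀ {z z′} → _ * z ≈ h * z′ → ∃ λ z″ → N * z ≈ h * z″
      cancel {z} {z′} eq
        with pr .PrimeElement.split h z′ (N * z , trans (sym eq) (trans (*-congʳ N≈) (*-assoc π N z)))
      ... | inj₁ π∣h = ⊥-elim (π∤h π∣h)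
      ... | inj₂ (z″ , z′≈) = z″ , *-cancelˡ (pr .PrimeElement.nonzero) (N * z) (h * z″) (begin
        π * (N * z)     ≈⟨ *-assoc π N z ⟨
        π * N * z       ≈⟨ *-congʳ N≈ ⟨
        _ * z           ≈⟨ eq ⟩
        h * z′          ≈⟨ *-congˡ z′≈ ⟩
        h * (π * z″)    ≈⟨ x∙yz≈y∙xz h π z″ ⟩
        π * (h * z″)    ∎)

    -- With x s = π z and x t = y z, cancelling x gives y s = π t; as π does not
    -- divide both x and y, one of the two equations yields π ∣ s.
    cancel-prime : ∀ {x y z π} → ¬ x ≈ 0# → Coprime x y → PrimeElement π →
      x ∣ π * z → x ∣ y * z → x ∣ z
    cancel-prime {x} {y} {z} {π} x≉0 cop pr (s , πz≈) (t , yz≈) = conclude π∣s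
      where
      open PrimeElement pr
      π∣ys : π ∣ y * s
      π∣ys = t , *-cancelˡ x≉0 (y * s) (π * t) (begin
        x * (y * s)   ≈⟨ x∙yz≈y∙xz x y s ⟩
        y * (x * s)   ≈⟨ *-congˡ πz≈ ⟨
        y * (π * z)   ≈⟨ x∙yz≈y∙xz y π z ⟩
        π * (y * z)   ≈⟨ *-congˡ yz≈ ⟩
        π * (x * t)   ≈⟨ x∙yz≈y∙xz π x t ⟩
        x * (π * t)   ∎)
      π∣s : π ∣ s
      π∣s with split x s (z , sym πz≈)
      ... | inj₂ π∣s = π∣s
      ... | inj₁ π∣x with split y s π∣ys
      ...   | inj₂ π∣s = π∣s
      ...   | inj₁ π∣y = ⊥-elim (nonunit (cop π π∣x π∣y))
      conclude : π ∣ s → x ∣ z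
      conclude (s₁ , s≈) = s₁ , *-cancelˡ nonzero z (x * s₁) (begin
        π * z          ≈⟨ πz≈ ⟩
        x * s          ≈⟨ *-congˡ s≈ ⟩
        x * (π * s₁)   ≈⟨ x∙yz≈y∙xz x π s₁ ⟩
        π * (x * s₁)   ∎)

    cancel-PrimeProduct : ∀ {x y z M} → ¬ x ≈ 0# → Coprime x y → PrimeProduct M →
      x ∣ M * z → x ∣ y * z → x ∣ z
    cancel-PrimeProduct {x} {z = z} x≉0 cop (unit {u} (r , 1≈ur)) x∣Mz x∣yz =
      ∣-respʳ (begin
        r * (u * z)   ≈⟨ x∙yz≈yx∙z r u z ⟩
        u * r * z     ≈⟨ *-congʳ 1≈ur ⟨
        1# * z        ≈⟨ *-identityˡ z ⟩
        z             ∎) (∣y⇒∣xy r x∣Mz)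
    cancel-PrimeProduct {x} {y} {z} x≉0 cop (prime {π = π} {N} pr M≈ N-product) x∣Mz x∣yz =
      cancel-PrimeProduct x≉0 cop N-product
        -- The prime is cancelled in front of `N * z`, so `x ∣ y * z` is multiplied by `N` first.
        (cancel-prime x≉0 cop pr
          (∣-respʳ (trans (*-congʳ M≈) (*-assoc π N z)) x∣Mz)
          (∣-respʳ (x∙yz≈y∙xz N y z) (∣y⇒∣xy N x∣yz)))
        x∣yz

    -- Multiplying the combination by `z` shows that `x` divides `M * h * z`. Coprimality makes `h`
    -- a product of primes as well, so `M * h` can be cancelled.
    coprime-∣* : ∀ {x y z} → WeakBézout x y → Coprime x y → x ∣ y * z → x ∣ z
    coprime-∣* {x} {y} {z} wb cop x∣yz with ≈0? x
    -- If `x` is zero, `y` divides both `x` and `y` and is therefore a unit.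
    ... | yes x≈0 with cop y (0# , trans x≈0 (sym (zeroʳ y))) ∣-refl
    ...   | r , 1≈yr = ∣-respʳ (begin
      r * (y * z)   ≈⟨ x∙yz≈yx∙z r y z ⟩
      y * r * z     ≈⟨ *-congʳ 1≈yr ⟨
      1# * z        ≈⟨ *-identityˡ z ⟩
      z             ∎) (∣y⇒∣xy r x∣yz)
    coprime-∣* {x} {y} {z} (weakBézout {h} {M} {u = u} {v} M-product N-product eq eqx eqy) cop x∣yz
        | no x≉0 =
      cancel-PrimeProduct x≉0 cop
        (PrimeProduct-* M-product (coprime⇒PrimeProduct cop N-product eqx eqy))
        (∣-respʳ (begin
           x * (u * z) + v * (y * z)   ≈⟨ lemma x u z v y ⟩
           (u * x + v * y) * z         ≈⟨ *-congʳ eq ⟨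
           M * h * z                   ∎)
          (∣-+ (∣x⇒∣xy (u * z) ∣-refl) (∣y⇒∣xy v x∣yz)))
        x∣yz
      where
      lemma : ∀ x u z v y → x * (u * z) + v * (y * z) ≈ (u * x + v * y) * z
      lemma = solve 5 (λ x u z v y → x :* (u :* z) :+ v :* (y :* z) := (u :* x :+ v :* y) :* z) refl

-- Second-order linear recurrences

module SecondOrderRecurrence {c ℓ} (R : CommutativeRing c ℓ) where

  open CommutativeRing R
  open Divisibility R
  open RingProperties ring using (+-cancelʳ)
  open SetoidReasoning setoid
  open import Algebra.Solver.Ring.NaturalCoefficients.Default commutativeSemiring using (solve; _:+_; _:*_; _:=_)

  -- Divisibility in the ring enters through Euclid's lemma alone, taken here as a parameter.
  module Fibonacci
    (euclid : ∀ x y z → Coprime x y → x ∣ y * z → x ∣ z)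
    (d g : Carrier) (d⊥g : Coprime d g)
    (F : ℕ → Carrier) (F₀≈0 : F 0 ≈ 0#) (F₁≈1 : F 1 ≈ 1#)
    (F-rec : ∀ n → F (suc (suc n)) ≈ d * F (suc n) + g * F n)
    where

    Recurrence : (ℕ → Carrier) → Set ℓ
    Recurrence G = ∀ n → G (suc (suc n)) ≈ d * G (suc n) + g * G n

    -- The addition formula G (n + m) = F m G (n + 1) + g F (m - 1) G n, with
    -- g F (m - 1) written as F (m + 1) - d F m so that m may be zero.
    addition : ∀ {G} → Recurrence G → ∀ m n →
      G (n ℕ.+ m) + d * F m * G n ≈ F m * G (suc n) + F (suc m) * G n
    addition {G} G-rec zero n = begin
      G (n ℕ.+ 0) + d * F 0 * G n      ≈⟨ +-cong (reflexive (≡.cong G (ℕP.+-identityʳ n)))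
                                            (trans (*-congʳ (trans (*-congˡ F₀≈0) (zeroʳ d))) (zeroˡ (G n))) ⟩
      G n + 0#                         ≈⟨ +-comm (G n) 0# ⟩
      0# + G n                         ≈⟨ +-cong (trans (*-congʳ F₀≈0) (zeroˡ (G (suc n))))
                                                 (trans (*-congʳ F₁≈1) (*-identityˡ (G n))) ⟨
      F 0 * G (suc n) + F 1 * G n      ∎
    addition {G} G-rec (suc m) n = begin
      G (n ℕ.+ suc m) + d * F (suc m) * G n
        ≈⟨ +-congʳ shifted ⟩
      (F (suc m) * G (suc n) + g * F m * G n) + d * F (suc m) * G n
        ≈⟨ solve 6 (λ d g f f₁ G G₁ → (f₁ :* G₁ :+ g :* f :* G) :+ d :* f₁ :* G := f₁ :* G₁ :+ (d :* f₁ :+ g :* f) :* G)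
             refl d g (F m) (F (suc m)) (G n) (G (suc n)) ⟩
      F (suc m) * G (suc n) + (d * F (suc m) + g * F m) * G n
        ≈⟨ +-congˡ (*-congʳ (F-rec m)) ⟨
      F (suc m) * G (suc n) + F (suc (suc m)) * G n ∎
      where
      -- One step is moved from `m` to `n`: the induction hypothesis is used at `suc n`, and its
      -- correction term is cancelled.
      shifted : G (n ℕ.+ suc m) ≈ F (suc m) * G (suc n) + g * F m * G n
      shifted = +-cancelʳ (d * F m * G (suc n)) _ _ (begin
        G (n ℕ.+ suc m) + d * F m * G (suc n)
          ≈⟨ +-congʳ (reflexive (≡.cong G (ℕP.+-suc n m))) ⟩
        G (suc n ℕ.+ m) + d * F m * G (suc n)
          ≈⟨ addition G-rec m (suc n) ⟩
        F m * G (suc (suc n)) + F (suc m) * G (suc n)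
          ≈⟨ +-congʳ (*-congˡ (G-rec n)) ⟩
        F m * (d * G (suc n) + g * G n) + F (suc m) * G (suc n)
          ≈⟨ solve 6 (λ d g f f₁ G G₁ → f :* (d :* G₁ :+ g :* G) :+ f₁ :* G₁ := (f₁ :* G₁ :+ g :* f :* G) :+ d :* f :* G₁)
               refl d g (F m) (F (suc m)) (G n) (G (suc n)) ⟩
        (F (suc m) * G (suc n) + g * F m * G n) + d * F m * G (suc n) ∎)

    -- Modulo `g` the recurrence reads `F (m + 2) ≡ d * F (m + 1)`, and `d` is coprime to `g`, so a
    -- common divisor descends to `F 1`, which is 1.
    F-suc-coprime-g : ∀ m → Coprime g (F (suc m))
    F-suc-coprime-g zero    t t∣g t∣F = ∣-respʳ F₁≈1 t∣F
    F-suc-coprime-g (suc m) t t∣g t∣F = F-suc-coprime-g m t t∣g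
      (euclid t d (F (suc m)) (Coprime-∣ˡ t∣g (Coprime-sym d⊥g))
        (∣-+-cancelʳ (∣-respʳ (F-rec m) t∣F) (∣x⇒∣xy (F m) t∣g)))

    -- A common divisor of `F (m + 1)` and `F (m + 2)` divides `g * F m`; being coprime to `g`, it
    -- divides `F m`, and the descent ends at `F 1`.
    F-coprime-F-suc : ∀ m → Coprime (F m) (F (suc m))
    F-coprime-F-suc zero    t _    t∣F₁ = ∣-respʳ F₁≈1 t∣F₁
    F-coprime-F-suc (suc m) t t∣F₁ t∣F₂ = F-coprime-F-suc m t
      (euclid t g (F m) (Coprime-∣ˡ t∣F₁ (Coprime-sym (F-suc-coprime-g m)))
        (∣-+-cancelˡ (∣-respʳ (F-rec m) t∣F₂) (∣y⇒∣xy d t∣F₁)))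
      t∣F₁

    module _ {G} (G-rec : Recurrence G) {e m} (e∣Fm : e ∣ F m) where

      ∣-up : ∀ n → e ∣ G n → e ∣ G (n ℕ.+ m)
      ∣-up n e∣G = ∣-+-cancelʳ
        (∣-respʳ (sym (addition G-rec m n)) (∣-+ (∣x⇒∣xy (G (suc n)) e∣Fm) (∣y⇒∣xy (F (suc m)) e∣G)))
        (∣y⇒∣xy (d * F m) e∣G)

      -- Modulo `e` the addition formula reads `G (n + m) ≡ F (suc m) * G n`. The factor `F (suc m)`
      -- cancels because `e` divides `F m`, which is coprime to it.
      ∣-down : ∀ n → e ∣ G (n ℕ.+ m) → e ∣ G n
      ∣-down n e∣G = euclid e (F (suc m)) (G n) (Coprime-∣ˡ e∣Fm (F-coprime-F-suc m))
        (∣-+-cancelˡ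
          (∣-respʳ (addition G-rec m n) (∣-+ e∣G (∣x⇒∣xy (G n) (∣y⇒∣xy d e∣Fm))))
          (∣x⇒∣xy (G (suc n)) e∣Fm))

      ∣-up* : ∀ k n → e ∣ G n → e ∣ G (n ℕ.+ k ℕ.* m)
      ∣-up* zero    n e∣G = ≡.subst (λ i → e ∣ G i) (≡.sym (ℕP.+-identityʳ n)) e∣G
      ∣-up* (suc k) n e∣G = ≡.subst (λ i → e ∣ G i) (ℕP.+-assoc n m (k ℕ.* m)) (∣-up* k (n ℕ.+ m) (∣-up n e∣G))

      ∣-down* : ∀ k n → e ∣ G (n ℕ.+ k ℕ.* m) → e ∣ G n
      ∣-down* zero    n e∣G = ≡.subst (λ i → e ∣ G i) (ℕP.+-identityʳ n) e∣G
      ∣-down* (suc k) n e∣G = ∣-down n (∣-down* k (n ℕ.+ m) (≡.subst (λ i → e ∣ G i) (≡.sym (ℕP.+-assoc n m (k ℕ.* m))) e∣G))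

    -- Everything divides `F 0`; moving up from index 0 in steps of `m` reaches `n`.
    F-∣ : ∀ {e m n} → m ℕD.∣ n → e ∣ F m → e ∣ F n
    F-∣ (divides k ≡.refl) e∣Fm = ∣-up* F-rec e∣Fm k 0 (∣-respʳ (sym F₀≈0) (∣0 _))

    -- Bézout's identity over the naturals has the form `gcd m n + y * n ≡ x * m`, or the same with
    -- the roles exchanged. So `e` divides `F` at the right-hand index and is moved down in steps of
    -- the other argument.
    F-gcd : ∀ {e} m n → e ∣ F m → e ∣ F n → e ∣ F (gcd m n)
    F-gcd {e} m n e∣Fm e∣Fn with ℕG.Bézout.identity (ℕG.gcd-GCD m n)
    ... | ℕG.Bézout.+- x y eq = ∣-down* F-rec e∣Fn y (gcd m n)
      (≡.subst (λ i → e ∣ F i) (≡.sym eq) (F-∣ (ℕD.n∣m*n x) e∣Fm))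
    ... | ℕG.Bézout.-+ x y eq = ∣-down* F-rec e∣Fm x (gcd m n)
      (≡.subst (λ i → e ∣ F i) (≡.sym eq) (F-∣ (ℕD.n∣m*n y) e∣Fn))

    module _ {L} (L-rec : Recurrence L) {α} (αL₀≈2 : α * L 0 ≈ 1# + 1#) (αL₁≈d : α * L 1 ≈ d) where

      -- This is `F (2 m) = α F m L m`, obtained by writing 2 as `α * L 0` and `d` as `α * L 1` in
      -- the addition formula for `F` and recognising the one for `L`.
      L∣F-double : ∀ m → L m ∣ F (2 ℕ.* m)
      -- Of the two added copies of `d * F m * F m`, one completes the addition formula for `F` and
      -- the other becomes the `α * L 1` term. Both return at the end as the correction term for
      -- `L`.
      L∣F-double m = α * F m , +-cancelʳ (d * F m * F m * (1# + 1#)) _ _ (begin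
        F (2 ℕ.* m) + d * F m * F m * (1# + 1#)
          ≈⟨ +-cong (reflexive (≡.cong (λ i → F (m ℕ.+ i)) (ℕP.+-identityʳ m))) (double (d * F m * F m)) ⟩
        F (m ℕ.+ m) + (d * F m * F m + d * F m * F m)
          ≈⟨ +-assoc _ _ _ ⟨
        F (m ℕ.+ m) + d * F m * F m + d * F m * F m
          ≈⟨ +-congʳ (addition F-rec m m) ⟩
        F m * F (suc m) + F (suc m) * F m + d * F m * F m
          ≈⟨ solve 3 (λ d f f₁ → f :* f₁ :+ f₁ :* f :+ d :* f :* f := (f :* f) :* d :+ (f :* f₁ :+ f :* f₁)) refl d (F m) (F (suc m)) ⟩
        F m * F m * d + (F m * F (suc m) + F m * F (suc m))
          ≈⟨ +-cong (*-congˡ αL₁≈d) (trans (*-congˡ αL₀≈2) (double (F m * F (suc m)))) ⟨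
        F m * F m * (α * L 1) + F m * F (suc m) * (α * L 0)
          ≈⟨ solve 5 (λ α f f₁ l₀ l₁ → f :* f :* (α :* l₁) :+ f :* f₁ :* (α :* l₀) := (α :* f) :* (f :* l₁ :+ f₁ :* l₀)) refl α (F m) (F (suc m)) (L 0) (L 1) ⟩
        α * F m * (F m * L 1 + F (suc m) * L 0)
          ≈⟨ *-congˡ (addition L-rec m 0) ⟨
        α * F m * (L m + d * F m * L 0)
          ≈⟨ solve 5 (λ α d f l l₀ → (α :* f) :* (l :+ d :* f :* l₀) := l :* (α :* f) :+ d :* f :* f :* (α :* l₀)) refl α d (F m) (L m) (L 0) ⟩
        L m * (α * F m) + d * F m * F m * (α * L 0)
          ≈⟨ +-congˡ (*-congˡ αL₀≈2) ⟩
        L m * (α * F m) + d * F m * F m * (1# + 1#) ∎)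
        where
        double : ∀ x → x * (1# + 1#) ≈ x + x
        double x = trans (distribˡ x 1# 1#) (+-cong (*-identityʳ x) (*-identityʳ x))

      -- The case where `m / gcd m n` is even and `n / gcd m n` odd. Every divisor of `F (2 r)`
      -- divides `L n` exactly when it divides `L r`; both `L r` and any common divisor of `F m` and
      -- `L n` are such divisors.
      gcd-F-L-even : ∀ m n s → 2 ℕ.* gcd m n ℕD.∣ m → n ≡ gcd m n ℕ.+ s ℕ.* (2 ℕ.* gcd m n) →
        IsGcd (L (gcd m n)) (F m) (L n)
      gcd-F-L-even m n s 2r∣m n≡ =
          F-∣ 2r∣m (L∣F-double r)
        , ≡.subst (λ i → L r ∣ L i) (≡.sym n≡) (∣-up* L-rec (L∣F-double r) s r ∣-refl)
        , λ e e∣Fm e∣Ln → ∣-down* L-rec (e∣F2r e e∣Fm e∣Ln) s r (≡.subst (λ i → e ∣ L i) n≡ e∣Ln)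
        where
        r : ℕ
        r = gcd m n
        e∣F2r : ∀ e → e ∣ F m → e ∣ L n → e ∣ F (2 ℕ.* r)
        -- Replacing `F m` by its multiple `F (2 m)` makes the gcd of the two indices equal to
        -- `2 * r`.
        e∣F2r e e∣Fm e∣Ln = ≡.subst (λ i → e ∣ F i) (≡.sym (ℕG.c*gcd[m,n]≡gcd[cm,cn] 2 m n))
          (F-gcd (2 ℕ.* m) (2 ℕ.* n) (F-∣ (ℕD.n∣m*n 2) e∣Fm) (∣-trans e∣Ln (L∣F-double n)))

      -- Modulo a divisor of L 0, the addition formula reads L r ≡ L 1 * F r.
      gcd-F-L-odd : ∀ m n → gcd m (2 ℕ.* n) ℕD.∣ n → Coprime (L 0) (L 1) →
        ∀ h → IsGcd h (L (gcd m n)) (L 0) → IsGcd h (F m) (L n)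
      gcd-F-L-odd m n c∣n L₀⊥L₁ h (h∣Lr , h∣L₀ , greatest) =
          F-∣ (ℕG.gcd[m,n]∣m m n) h∣Fr
        , to-n (ℕG.gcd[m,n]∣n m n) h∣Fr h∣L₀
        , λ e e∣Fm e∣Ln →
            -- By `c∣n`, the index `gcd m (2 * n)` divides both `m` and `n`, hence `r`.
            let e∣Fr = F-∣ (ℕG.gcd-greatest (ℕG.gcd[m,n]∣m m (2 ℕ.* n)) c∣n)
                         (F-gcd m (2 ℕ.* n) e∣Fm (∣-trans e∣Ln (L∣F-double n)))
                e∣L₀ = from-n (ℕG.gcd[m,n]∣n m n) e∣Fr e∣Ln
            in greatest e (∣-up L-rec e∣Fr 0 e∣L₀) e∣L₀
        where
        r : ℕ
        r = gcd m n
        h∣Fr : h ∣ F r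
        h∣Fr = euclid h (L 1) (F r) (Coprime-∣ˡ h∣L₀ L₀⊥L₁)
          (∣-respʳ (*-comm (F r) (L 1))
            (∣-+-cancelʳ
              (∣-respʳ (addition L-rec r 0) (∣-+ h∣Lr (∣y⇒∣xy (d * F r) h∣L₀)))
              (∣y⇒∣xy (F (suc r)) h∣L₀)))
        to-n : ∀ {e n} → r ℕD.∣ n → e ∣ F r → e ∣ L 0 → e ∣ L n
        to-n (divides k ≡.refl) e∣Fr = ∣-up* L-rec e∣Fr k 0
        from-n : ∀ {e n} → r ℕD.∣ n → e ∣ F r → e ∣ L n → e ∣ L 0
        from-n (divides k ≡.refl) e∣Fr = ∣-down* L-rec e∣Fr k 0

open import Defs
open import Data.Integer using (ℤ; +_; -[1+_]; 0ℤ; 1ℤ)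
import Data.Integer as ℤ
import Data.Integer.Divisibility.Signed as ℤD
import Data.Integer.Properties as ℤP
open import Data.Integer.Solver using (module +-*-Solver)
open import Data.List using ([]; _∷_; length)
open import Data.List.Relation.Unary.All using (All; []; _∷_)
open import Data.Nat.ListAction using (product)
open import Data.Nat.Primality using (Prime; euclidsLemma; prime⇒nonZero; prime[2]; ¬prime[1])
open import Data.Nat.Primality.Factorisation using (factorise; module PrimeFactorisation)
open import Function.Base using (_∘_)
open import Relation.Binary.Bundles using (Setoid)
open import Relation.Nullary.Decidable as Dec using ()
open import Relation.Unary using (Pred)
open ≡ using (refl; cong; cong₂; sym; trans; subst)

-- The ring of integer polynomials

≈-setoid : Setoid 0ℓ 0ℓ
≈-setoid = record
  { Carrier = Poly
  ; _≈_ = _≈_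
  ; isEquivalence = record
    { refl = λ i → refl
    ; sym = λ p≈q i → sym (p≈q i)
    ; trans = λ p≈q q≈r i → trans (p≈q i) (q≈r i)
    }
  }

private
  module ≈ = Setoid ≈-setoid
  module ≈-Reasoning = SetoidReasoning ≈-setoid

shift : Poly → Poly
shift p = 0ℤ ∷ p

coeff-+P : ∀ p q i → coeff (p +P q) i ≡ coeff p i ℤ.+ coeff q i
coeff-+P []      q       i       = sym (ℤP.+-identityˡ (coeff q i))
coeff-+P (a ∷ p) []      i       = sym (ℤP.+-identityʳ (coeff (a ∷ p) i))
coeff-+P (a ∷ p) (b ∷ q) zero    = refl
coeff-+P (a ∷ p) (b ∷ q) (suc i) = coeff-+P p q i

coeff-scale : ∀ c p i → coeff (scale c p) i ≡ c ℤ.* coeff p i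
coeff-scale c []      i       = sym (ℤP.*-zeroʳ c)
coeff-scale c (a ∷ p) zero    = refl
coeff-scale c (a ∷ p) (suc i) = coeff-scale c p i

-- Here and below the polynomials are explicit arguments, since unification cannot recover them from
-- a coefficientwise equation.
+P-cong : ∀ p p′ q q′ → p ≈ p′ → q ≈ q′ → p +P q ≈ p′ +P q′
+P-cong p p′ q q′ p≈ q≈ i =
  trans (coeff-+P p q i) (trans (cong₂ ℤ._+_ (p≈ i) (q≈ i)) (sym (coeff-+P p′ q′ i)))

+P-assoc : ∀ p q r → (p +P q) +P r ≈ p +P (q +P r)
+P-assoc p q r i
  rewrite coeff-+P (p +P q) r i | coeff-+P p q i | coeff-+P p (q +P r) i | coeff-+P q r i
  = ℤP.+-assoc (coeff p i) (coeff q i) (coeff r i)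

+P-comm : ∀ p q → p +P q ≈ q +P p
+P-comm p q i rewrite coeff-+P p q i | coeff-+P q p i = ℤP.+-comm (coeff p i) (coeff q i)

+P-identityʳ : ∀ p → p +P 0P ≈ p
+P-identityʳ p i = trans (coeff-+P p 0P i) (ℤP.+-identityʳ (coeff p i))

-P_ : Poly → Poly
-P p = scale ℤ.-1ℤ p

+P-inverseʳ : ∀ p → p +P (-P p) ≈ 0P
+P-inverseʳ p i
  rewrite coeff-+P p (-P p) i | coeff-scale ℤ.-1ℤ p i | ℤP.-1*i≡-i (coeff p i)
  = ℤP.+-inverseʳ (coeff p i)

scale-cong : ∀ c p q → p ≈ q → scale c p ≈ scale c q
scale-cong c p q p≈q i =
  trans (coeff-scale c p i) (trans (cong (c ℤ.*_) (p≈q i)) (sym (coeff-scale c q i)))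

scale-+ : ∀ c p q → scale c (p +P q) ≈ scale c p +P scale c q
scale-+ c p q i
  rewrite coeff-scale c (p +P q) i | coeff-+P p q i | coeff-+P (scale c p) (scale c q) i
        | coeff-scale c p i | coeff-scale c q i
  = ℤP.*-distribˡ-+ c (coeff p i) (coeff q i)

scale-scale : ∀ a b p → scale a (scale b p) ≈ scale (a ℤ.* b) p
scale-scale a b p i
  rewrite coeff-scale a (scale b p) i | coeff-scale b p i | coeff-scale (a ℤ.* b) p i
  = sym (ℤP.*-assoc a b (coeff p i))

scale-0 : ∀ p → scale 0ℤ p ≈ 0P
scale-0 p i = trans (coeff-scale 0ℤ p i) (ℤP.*-zeroˡ (coeff p i))

scale-shift : ∀ c p → scale c (shift p) ≈ shift (scale c p)
scale-shift c p zero    = ℤP.*-zeroʳ c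
scale-shift c p (suc i) = refl

∷-cong : ∀ {a b} p q → a ≡ b → p ≈ q → (a ∷ p) ≈ (b ∷ q)
∷-cong p q a≡b p≈q zero    = a≡b
∷-cong p q a≡b p≈q (suc i) = p≈q i

shift-+ : ∀ p q → shift (p +P q) ≈ shift p +P shift q
shift-+ p q zero    = refl
shift-+ p q (suc i) = refl

∷-cons : ∀ a p → (a ∷ p) ≈ const a +P shift p
∷-cons a p zero    = sym (ℤP.+-identityʳ a)
∷-cons a p (suc i) = refl

+P-interchange : ∀ p q r s → (p +P q) +P (r +P s) ≈ (p +P r) +P (q +P s)
+P-interchange p q r s i
  rewrite coeff-+P (p +P q) (r +P s) i | coeff-+P p q i | coeff-+P r s i
        | coeff-+P (p +P r) (q +P s) i | coeff-+P p r i | coeff-+P q s i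
  = solve 4 (λ p q r s → (p :+ q) :+ (r :+ s) := (p :+ r) :+ (q :+ s)) refl
      (coeff p i) (coeff q i) (coeff r i) (coeff s i)
  where open +-*-Solver

*P-congˡ : ∀ p q q′ → q ≈ q′ → p *P q ≈ p *P q′
*P-congˡ []      q q′ q≈ i = refl
*P-congˡ (a ∷ p) q q′ q≈ =
  +P-cong (scale a q) (scale a q′) (shift (p *P q)) (shift (p *P q′))
    (scale-cong a q q′ q≈) (∷-cong (p *P q) (p *P q′) refl (*P-congˡ p q q′ q≈))

*P-distribˡ : ∀ p q r → p *P (q +P r) ≈ p *P q +P p *P r
*P-distribˡ []      q r i = refl
*P-distribˡ (a ∷ p) q r = begin
  scale a (q +P r) +P shift (p *P (q +P r))
    ≈⟨ +P-cong (scale a (q +P r)) (scale a q +P scale a r)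
               (shift (p *P (q +P r))) (shift (p *P q) +P shift (p *P r))
         (scale-+ a q r)
         (≈.trans {shift (p *P (q +P r))} {shift (p *P q +P p *P r)} {shift (p *P q) +P shift (p *P r)}
            (∷-cong (p *P (q +P r)) (p *P q +P p *P r) refl (*P-distribˡ p q r))
            (shift-+ (p *P q) (p *P r))) ⟩
  (scale a q +P scale a r) +P (shift (p *P q) +P shift (p *P r))
    ≈⟨ +P-interchange (scale a q) (scale a r) (shift (p *P q)) (shift (p *P r)) ⟩
  (scale a q +P shift (p *P q)) +P (scale a r +P shift (p *P r)) ∎
  where open ≈-Reasoning

*P-0 : ∀ p → p *P 0P ≈ 0P
*P-0 []      i       = refl
*P-0 (a ∷ p) zero    = refl
*P-0 (a ∷ p) (suc i) = *P-0 p i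

*P-scale : ∀ c p q → p *P scale c q ≈ scale c (p *P q)
*P-scale c []      q i = refl
*P-scale c (a ∷ p) q = begin
  scale a (scale c q) +P shift (p *P scale c q)
    ≈⟨ +P-cong (scale a (scale c q)) (scale c (scale a q)) (shift (p *P scale c q)) (scale c (shift (p *P q)))
         (λ i → trans (scale-scale a c q i)
                  (trans (cong (λ z → coeff (scale z q) i) (ℤP.*-comm a c)) (sym (scale-scale c a q i))))
         (λ i → trans (∷-cong (p *P scale c q) (scale c (p *P q)) refl (*P-scale c p q) i)
                  (sym (scale-shift c (p *P q) i))) ⟩
  scale c (scale a q) +P scale c (shift (p *P q))
    ≈⟨ scale-+ c (scale a q) (shift (p *P q)) ⟨
  scale c (scale a q +P shift (p *P q)) ∎
  where open ≈-Reasoning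

*P-shift : ∀ p q → p *P shift q ≈ shift (p *P q)
*P-shift []      q zero    = refl
*P-shift []      q (suc i) = refl
*P-shift (a ∷ p) q = begin
  scale a (shift q) +P shift (p *P shift q)
    ≈⟨ +P-cong (scale a (shift q)) (shift (scale a q)) (shift (p *P shift q)) (shift (shift (p *P q)))
         (scale-shift a q) (∷-cong (p *P shift q) (shift (p *P q)) refl (*P-shift p q)) ⟩
  shift (scale a q) +P shift (shift (p *P q))
    ≈⟨ shift-+ (scale a q) (shift (p *P q)) ⟨
  shift (scale a q +P shift (p *P q)) ∎
  where open ≈-Reasoning

const-*P : ∀ c p → const c *P p ≈ scale c p
const-*P c p i = trans (coeff-+P (scale c p) (0ℤ ∷ []) i)
  (trans (cong (λ z → coeff (scale c p) i ℤ.+ z) (lemma i)) (ℤP.+-identityʳ (coeff (scale c p) i)))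
  where
  lemma : ∀ i → coeff (0ℤ ∷ []) i ≡ 0ℤ
  lemma zero    = refl
  lemma (suc i) = refl

*P-const : ∀ c p → p *P const c ≈ scale c p
*P-const c []      i       = refl
*P-const c (a ∷ p) zero    = trans (ℤP.+-identityʳ (a ℤ.* c)) (ℤP.*-comm a c)
*P-const c (a ∷ p) (suc i) = *P-const c p i

*P-comm : ∀ p q → p *P q ≈ q *P p
*P-comm []      q i = sym (*P-0 q i)
*P-comm (a ∷ p) q = begin
  scale a q +P shift (p *P q)
    ≈⟨ +P-cong (scale a q) (q *P const a) (shift (p *P q)) (q *P shift p)
         (λ i → sym (*P-const a q i))
         (λ i → trans (∷-cong (p *P q) (q *P p) refl (*P-comm p q) i) (sym (*P-shift q p i))) ⟩
  q *P const a +P q *P shift p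
    ≈⟨ *P-distribˡ q (const a) (shift p) ⟨
  q *P (const a +P shift p)
    ≈⟨ *P-congˡ q (a ∷ p) (const a +P shift p) (∷-cons a p) ⟨
  q *P (a ∷ p) ∎
  where open ≈-Reasoning

*P-cong : ∀ p p′ q q′ → p ≈ p′ → q ≈ q′ → p *P q ≈ p′ *P q′
*P-cong p p′ q q′ p≈ q≈ = begin
  p *P q     ≈⟨ *P-congˡ p q q′ q≈ ⟩
  p *P q′    ≈⟨ *P-comm p q′ ⟩
  q′ *P p    ≈⟨ *P-congˡ q′ p p′ p≈ ⟩
  q′ *P p′   ≈⟨ *P-comm q′ p′ ⟩
  p′ *P q′   ∎
  where open ≈-Reasoning

*P-distribʳ : ∀ p q r → (q +P r) *P p ≈ q *P p +P r *P p
*P-distribʳ p q r = begin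
  (q +P r) *P p      ≈⟨ *P-comm (q +P r) p ⟩
  p *P (q +P r)      ≈⟨ *P-distribˡ p q r ⟩
  p *P q +P p *P r   ≈⟨ +P-cong (p *P q) (q *P p) (p *P r) (r *P p) (*P-comm p q) (*P-comm p r) ⟩
  q *P p +P r *P p   ∎
  where open ≈-Reasoning

scale-*P : ∀ c p q → scale c p *P q ≈ scale c (p *P q)
scale-*P c p q = begin
  scale c p *P q     ≈⟨ *P-comm (scale c p) q ⟩
  q *P scale c p     ≈⟨ *P-scale c q p ⟩
  scale c (q *P p)   ≈⟨ scale-cong c (q *P p) (p *P q) (*P-comm q p) ⟩
  scale c (p *P q)   ∎
  where open ≈-Reasoning

shift-*P : ∀ p q → shift p *P q ≈ shift (p *P q)
shift-*P p q = +P-cong (scale 0ℤ q) 0P (shift (p *P q)) (shift (p *P q)) (scale-0 q) (λ i → refl)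

*P-assoc : ∀ p q r → (p *P q) *P r ≈ p *P (q *P r)
*P-assoc []      q r i = refl
*P-assoc (a ∷ p) q r = begin
  (scale a q +P shift (p *P q)) *P r
    ≈⟨ *P-distribʳ r (scale a q) (shift (p *P q)) ⟩
  scale a q *P r +P shift (p *P q) *P r
    ≈⟨ +P-cong (scale a q *P r) (scale a (q *P r)) (shift (p *P q) *P r) (shift (p *P (q *P r)))
         (scale-*P a q r)
         (λ i → trans (shift-*P (p *P q) r i)
                  (∷-cong ((p *P q) *P r) (p *P (q *P r)) refl (*P-assoc p q r) i)) ⟩
  scale a (q *P r) +P shift (p *P (q *P r)) ∎
  where open ≈-Reasoning

*P-identityˡ : ∀ p → 1P *P p ≈ p
*P-identityˡ p i = trans (const-*P 1ℤ p i) (trans (coeff-scale 1ℤ p i) (ℤP.*-identityˡ (coeff p i)))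

ℤ[X] : CommutativeRing 0ℓ 0ℓ
ℤ[X] = record
  { Carrier = Poly
  ; _≈_ = _≈_
  ; _+_ = _+P_
  ; _*_ = _*P_
  ; -_ = -P_
  ; 0# = 0P
  ; 1# = 1P
  ; isCommutativeRing = record
    { isRing = record
      { +-isAbelianGroup = record
        { isGroup = record
          { isMonoid = record
            { isSemigroup = record
              { isMagma = record
                { isEquivalence = ≈.isEquivalence
                ; ∙-cong = λ {p} {p′} {q} {q′} → +P-cong p p′ q q′
                }
              ; assoc = +P-assoc
              }
            ; identity = (λ p i → refl) , +P-identityʳ
            }
          ; inverse = (λ p i → trans (+P-comm (-P p) p i) (+P-inverseʳ p i)) , +P-inverseʳ
          ; ⁻¹-cong = λ {p} {q} → scale-cong ℤ.-1ℤ p q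
          }
        ; comm = +P-comm
        }
      ; *-cong = λ {p} {p′} {q} {q′} → *P-cong p p′ q q′
      ; *-assoc = *P-assoc
      ; *-identity = *P-identityˡ , λ p i → trans (*P-comm p 1P i) (*P-identityˡ p i)
      ; distrib = *P-distribˡ , *P-distribʳ
      }
    ; *-comm = *P-comm
    }
  }

-- Gauss's lemma and Euclid's lemma for integer polynomials

-- Covers both the zero ideal and the ideal of a prime number, so that one induction shows that the
-- polynomial ring is a domain and proves Gauss's lemma.
record PrimeIdeal (I : Pred ℤ 0ℓ) : Set where
  field
    0∈        : I 0ℤ
    +-cancelˡ : ∀ {a} b → I a → I (a ℤ.+ b) → I b
    *-absorb  : ∀ {a} b → I a → I (a ℤ.* b)
    split     : ∀ a b → I (a ℤ.* b) → I a ⊎ I b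
    _∈?       : ∀ a → Dec (I a)

module Gauss {I : Pred ℤ 0ℓ} (I-prime : PrimeIdeal I) where

  open PrimeIdeal I-prime

  AllCoeffs : Poly → Set
  AllCoeffs p = ∀ i → I (coeff p i)

  AllCoeffs-∷ : ∀ {a} p → I a → AllCoeffs p → AllCoeffs (a ∷ p)
  AllCoeffs-∷ p a∈ p∈ zero    = a∈
  AllCoeffs-∷ p a∈ p∈ (suc i) = p∈ i

  allCoeffs? : ∀ p → Dec (AllCoeffs p)
  allCoeffs? []      = yes (λ i → 0∈)
  allCoeffs? (a ∷ p) with a ∈? | allCoeffs? p
  ... | yes a∈ | yes p∈ = yes (AllCoeffs-∷ p a∈ p∈)
  ... | no a∉  | _      = no (λ ap∈ → a∉ (ap∈ 0))
  ... | yes _  | no p∉  = no (λ ap∈ → p∉ (ap∈ ∘ suc))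

  -- If `a` lies in `I`, so does all that `scale a q` contributes; the rest is `p *P q`, shifted by
  -- one index.
  AllCoeffs-tail : ∀ {a} p q → I a → AllCoeffs ((a ∷ p) *P q) → AllCoeffs (p *P q)
  AllCoeffs-tail {a} p q a∈ pq∈ i = +-cancelˡ (coeff (p *P q) i)
    (subst I (sym (coeff-scale a q (suc i))) (*-absorb (coeff q (suc i)) a∈))
    (subst I (coeff-+P (scale a q) (shift (p *P q)) (suc i)) (pq∈ (suc i)))

  -- A constant term in `I` is stripped, and the matching recursive call, passed in as an argument,
  -- finishes. If neither lies in `I`, the constant term `a * b` of the product contradicts
  -- primality.
  gauss-∷ : ∀ a p b q →
    (AllCoeffs (p *P (b ∷ q)) → AllCoeffs p ⊎ AllCoeffs (b ∷ q)) →
    (AllCoeffs ((a ∷ p) *P q) → AllCoeffs (a ∷ p) ⊎ AllCoeffs q) →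
    AllCoeffs ((a ∷ p) *P (b ∷ q)) → AllCoeffs (a ∷ p) ⊎ AllCoeffs (b ∷ q)
  gauss-∷ a p b q recˡ recʳ pq∈ with a ∈? | b ∈?
  ... | yes a∈ | _ = Sum.map₁ (AllCoeffs-∷ p a∈) (recˡ (AllCoeffs-tail p (b ∷ q) a∈ pq∈))
  ... | no _ | yes b∈ = Sum.map₂ (AllCoeffs-∷ q b∈) (recʳ λ i →
    subst I (*P-comm q (a ∷ p) i)
      (AllCoeffs-tail q (a ∷ p) b∈ (λ j → subst I (*P-comm (a ∷ p) (b ∷ q) j) (pq∈ j)) i))
  ... | no a∉ | no b∉ with split a b (subst I (ℤP.+-identityʳ (a ℤ.* b)) (pq∈ 0))
  ...   | inj₁ a∈ = ⊥-elim (a∉ a∈)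
  ...   | inj₂ b∈ = ⊥-elim (b∉ b∈)

  gauss : ∀ p q → AllCoeffs (p *P q) → AllCoeffs p ⊎ AllCoeffs q
  gauss []      q       _ = inj₁ (λ i → 0∈)
  gauss (a ∷ p) []      _ = inj₂ (λ i → 0∈)
  gauss (a ∷ p) (b ∷ q)   = gauss-∷ a p b q (gauss p (b ∷ q)) (gauss (a ∷ p) q)

zeroIdeal : PrimeIdeal (_≡ 0ℤ)
zeroIdeal = record
  { 0∈        = refl
  ; +-cancelˡ = λ b a≡0 a+b≡0 → trans (sym (ℤP.+-identityˡ b)) (trans (cong (ℤ._+ b) (sym a≡0)) a+b≡0)
  ; *-absorb  = λ b a≡0 → trans (cong (ℤ._* b) a≡0) (ℤP.*-zeroˡ b)
  ; split     = λ a b → ℤP.i*j≡0⇒i≡0∨j≡0 a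
  ; _∈?       = ℤ._≟ 0ℤ
  }

primeIdeal : ∀ {π} → Prime π → PrimeIdeal (+ π ℤD.∣_)
primeIdeal {π} pr = record
  { 0∈        = ℤD.∣ᵤ⇒∣ (π ℕD.∣0)
  ; +-cancelˡ = λ b π∣a π∣a+b → ℤD.∣m+n∣m⇒∣n π∣a+b π∣a
  ; *-absorb  = λ b π∣a → ℤD.∣m⇒∣m*n b π∣a
  ; split     = λ a b π∣ab → Sum.map ℤD.∣ᵤ⇒∣ ℤD.∣ᵤ⇒∣
      (euclidsLemma ℤ.∣ a ∣ ℤ.∣ b ∣ pr (subst (π ℕD.∣_) (ℤP.abs-* a b) (ℤD.∣⇒∣ᵤ π∣ab)))
  ; _∈?       = + π ℤD.∣?_
  }

open Divisibility ℤ[X] using (Coprime)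
-- For the zero ideal `AllCoeffs p` unfolds to `p ≈ 0P`, so the two arguments are a zero test and
-- the absence of zero divisors.
open Domain.EuclidLemma ℤ[X] (Gauss.allCoeffs? zeroIdeal) (Gauss.gauss zeroIdeal)

-- Integer primes, `X` and nonzero constants in the polynomial ring.

const-∣⇒ : ∀ a p → const a ∣P p → ∀ i → a ℤD.∣ coeff p i
const-∣⇒ a p (r , p≈) i = ℤD.divides (coeff r i)
  (trans (p≈ i) (trans (const-*P a r i) (trans (coeff-scale a r i) (ℤP.*-comm a (coeff r i)))))

const-∣⇐ : ∀ a p → (∀ i → a ℤD.∣ coeff p i) → const a ∣P p
const-∣⇐ a p a∣ = quotients p a∣ , λ i →
  trans (lemma p a∣ i) (trans (sym (coeff-scale a (quotients p a∣) i)) (sym (const-*P a (quotients p a∣) i)))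
  where
  quotients : ∀ p → (∀ i → a ℤD.∣ coeff p i) → Poly
  quotients []      a∣ = []
  quotients (b ∷ p) a∣ = ℤD._∣_.quotient (a∣ 0) ∷ quotients p (a∣ ∘ suc)
  lemma : ∀ p a∣ i → coeff p i ≡ a ℤ.* coeff (quotients p a∣) i
  lemma []      a∣ i       = sym (ℤP.*-zeroʳ a)
  lemma (b ∷ p) a∣ zero    = trans (ℤD._∣_.equality (a∣ 0)) (ℤP.*-comm (ℤD._∣_.quotient (a∣ 0)) a)
  lemma (b ∷ p) a∣ (suc i) = lemma p (a∣ ∘ suc) i

const-prime : ∀ {π} → Prime π → PrimeElement (const (+ π))
const-prime {π} pr = record
  { nonzero = λ π≈0 → ℕ.≢-nonZero⁻¹ π {{prime⇒nonZero pr}} (ℤP.+-injective (π≈0 0))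
  ; nonunit = λ π∣1 → ¬prime[1] (subst Prime (ℕD.∣1⇒≡1 (ℤD.∣⇒∣ᵤ (const-∣⇒ (+ π) 1P π∣1 0))) pr)
  ; _∣?     = λ p → Dec.map′ (const-∣⇐ (+ π) p) (const-∣⇒ (+ π) p) (allCoeffs? p)
  ; split   = λ p q π∣pq → Sum.map (const-∣⇐ (+ π) p) (const-∣⇐ (+ π) q)
      (gauss p q (const-∣⇒ (+ π) (p *P q) π∣pq))
  }
  where open Gauss (primeIdeal pr)

X : Poly
X = shift 1P

X-*P : ∀ p → X *P p ≈ shift p
X-*P p = ≈.trans {X *P p} {shift (1P *P p)} {shift p} (shift-*P 1P p) (∷-cong (1P *P p) p refl (*P-identityˡ p))

coeff₀-*P : ∀ p q → coeff (p *P q) 0 ≡ coeff p 0 ℤ.* coeff q 0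
coeff₀-*P []      q = sym (ℤP.*-zeroˡ (coeff q 0))
coeff₀-*P (a ∷ p) q = trans (coeff-+P (scale a q) (shift (p *P q)) 0)
  (trans (ℤP.+-identityʳ (coeff (scale a q) 0)) (coeff-scale a q 0))

X∣⇒ : ∀ p → X ∣P p → coeff p 0 ≡ 0ℤ
X∣⇒ p (r , p≈) = trans (p≈ 0) (X-*P r 0)

X∣⇐ : ∀ p → coeff p 0 ≡ 0ℤ → X ∣P p
X∣⇐ []      _   = [] , ≈.sym {X *P []} {[]} (*P-0 X)
X∣⇐ (a ∷ p) a≡0 = p , ≈.trans {a ∷ p} {shift p} {X *P p} (∷-cong p p a≡0 (λ i → refl)) (≈.sym {X *P p} {shift p} (X-*P p))

X-prime : PrimeElement X
X-prime = record
  { nonzero = λ X≈0 → 1≢0 (X≈0 1)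
  ; nonunit = λ X∣1 → 1≢0 (X∣⇒ 1P X∣1)
  ; _∣?     = λ p → Dec.map′ (X∣⇐ p) (X∣⇒ p) (coeff p 0 ℤ.≟ 0ℤ)
  ; split   = λ p q X∣pq → Sum.map (X∣⇐ p) (X∣⇐ q)
      (ℤP.i*j≡0⇒i≡0∨j≡0 (coeff p 0) (trans (sym (coeff₀-*P p q)) (X∣⇒ (p *P q) X∣pq)))
  }
  where
  1≢0 : ¬ 1ℤ ≡ 0ℤ
  1≢0 ()

1-PrimeProduct : PrimeProduct 1P
1-PrimeProduct = unit (1P , λ i → sym (*P-identityˡ 1P i))

product-PrimeProduct : ∀ ns → All Prime ns → PrimeProduct (const (+ product ns))
product-PrimeProduct []       []         = 1-PrimeProduct
product-PrimeProduct (n ∷ ns) (pr ∷ prs) =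
  prime (const-prime pr) (λ i → trans (eq i) (sym (const-*P (+ n) (const (+ product ns)) i)))
    (product-PrimeProduct ns prs)
  where
  eq : const (+ product (n ∷ ns)) ≈ scale (+ n) (const (+ product ns))
  eq = ∷-cong [] [] (ℤP.pos-* n (product ns)) (λ i → refl)

const-PrimeProduct : ∀ a → ¬ a ≡ 0ℤ → PrimeProduct (const a)
const-PrimeProduct (+ zero)  a≢0 = ⊥-elim (a≢0 refl)
const-PrimeProduct (+ suc n) _   =
  subst (λ k → PrimeProduct (const (+ k))) (sym isFactorisation) (product-PrimeProduct _ factorsPrime)
  where open PrimeFactorisation (factorise (suc n))
const-PrimeProduct -[1+ n ]  _   =
  subst PrimeProduct (cong const -1*suc≡)
    -- The unit `const -1` is its own inverse.
    (PrimeProduct-unit* {const ℤ.-1ℤ} {const (+ suc n)} (const ℤ.-1ℤ , λ i → refl)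
      (const-PrimeProduct (+ suc n) λ ()))
  where
  -1*suc≡ : ℤ.-1ℤ ℤ.* + suc n ℤ.+ 0ℤ ≡ -[1+ n ]
  -1*suc≡ = trans (ℤP.+-identityʳ (ℤ.-1ℤ ℤ.* + suc n)) (ℤP.-1*i≡-i (+ suc n))

-- The Euclidean algorithm for integer polynomials.

length-+P : ∀ p q → length (p +P q) ≡ length p ℕ.⊔ length q
length-+P []      q       = refl
length-+P (a ∷ p) []      = refl
length-+P (a ∷ p) (b ∷ q) = cong suc (length-+P p q)

length-scale : ∀ c p → length (scale c p) ≡ length p
length-scale c []      = refl
length-scale c (a ∷ p) = cong suc (length-scale c p)

X-PrimeProduct : PrimeProduct X
X-PrimeProduct = prime X-prime (λ i → trans (sym (*P-identityˡ X i)) (*P-comm 1P X i)) 1-PrimeProduct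

-- A common factor X is harmless, so the Euclidean algorithm can eliminate the
-- lowest coefficients instead of the leading ones: b (a + X p) - a (b + X q) is
-- X times a shorter polynomial, and trailing zeros need no normalisation.
bézout-step : ∀ n → (∀ p q → length p ℕ.+ length q ℕ.≤ n → WeakBézout p q) →
  ∀ a p b q → length q ℕ.≤ length p → length p ℕ.+ suc (length q) ℕ.≤ n →
  WeakBézout (a ∷ p) (b ∷ q)
bézout-step n rec a p b q q≤p len with b ℤ.≟ 0ℤ
-- Now `b ∷ q` is `X` times `q`, so the second polynomial is the one reduced, hence the two
-- symmetries.
... | yes b≡0 = WeakBézout-sym (WeakBézout-reduce {X} {1P} {0P} {0P} {q} {b ∷ q} {a ∷ p}
  X-PrimeProduct 1-PrimeProduct
  (λ i → trans (eq i) (sym (+P-identityʳ (1P *P (b ∷ q)) i)))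
  (λ i → trans (sym (eq i)) (sym (+P-identityʳ (X *P q) i)))
  (WeakBézout-sym (rec (a ∷ p) q (subst (ℕ._≤ n) (ℕP.+-suc (length p) (length q)) len))))
  where
  eq : X *P q ≈ 1P *P (b ∷ q)
  eq i = trans (X-*P q i)
    (trans (∷-cong q q (sym b≡0) (λ i → refl) i) (sym (*P-identityˡ (b ∷ q) i)))
... | no b≢0 = WeakBézout-reduce {X} {const b} {const a} {const (ℤ.- a)} {r} {a ∷ p} {b ∷ q}
  X-PrimeProduct (const-PrimeProduct b b≢0) eq₁ eq₂
  (rec r (b ∷ q) (ℕP.≤-trans (ℕP.+-monoˡ-≤ (suc (length q)) length-r) len))
  where
  open +-*-Solver
  r : Poly
  r = scale b p +P scale (ℤ.- a) q
  coeff-r : ∀ i → coeff r i ≡ b ℤ.* coeff p i ℤ.+ (ℤ.- a) ℤ.* coeff q i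
  coeff-r i = trans (coeff-+P (scale b p) (scale (ℤ.- a) q) i)
    (cong₂ ℤ._+_ (coeff-scale b p i) (coeff-scale (ℤ.- a) q i))
  -- As `q` is no longer than `p`, replacing `a ∷ p` by `r` lowers the total length.
  length-r : length r ℕ.≤ length p
  length-r = ℕP.≤-reflexive (begin
    length r                                         ≡⟨ length-+P (scale b p) (scale (ℤ.- a) q) ⟩
    length (scale b p) ℕ.⊔ length (scale (ℤ.- a) q)  ≡⟨ cong₂ ℕ._⊔_ (length-scale b p) (length-scale (ℤ.- a) q) ⟩
    length p ℕ.⊔ length q                            ≡⟨ ℕP.m≥n⇒m⊔n≡m q≤p ⟩
    length p                                         ∎)
    where open ≡.≡-Reasoning
  eq₁ : X *P r ≈ const b *P (a ∷ p) +P const (ℤ.- a) *P (b ∷ q)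
  eq₁ i = trans (X-*P r i) (trans (expand i)
    (sym (+P-cong (const b *P (a ∷ p)) (scale b (a ∷ p)) (const (ℤ.- a) *P (b ∷ q)) (scale (ℤ.- a) (b ∷ q))
      (const-*P b (a ∷ p)) (const-*P (ℤ.- a) (b ∷ q)) i)))
    where
    expand : shift r ≈ scale b (a ∷ p) +P scale (ℤ.- a) (b ∷ q)
    expand = ∷-cong r r (solve 2 (λ a b → con 0ℤ := b :* a :+ (:- a) :* b) refl a b) (λ i → refl)
  eq₂ : const b *P (a ∷ p) ≈ X *P r +P const a *P (b ∷ q)
  eq₂ i = trans (const-*P b (a ∷ p) i) (trans (expand i)
    (sym (+P-cong (X *P r) (shift r) (const a *P (b ∷ q)) (scale a (b ∷ q)) (X-*P r) (const-*P a (b ∷ q)) i)))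
    where
    expand : scale b (a ∷ p) ≈ shift r +P scale a (b ∷ q)
    expand = ∷-cong (scale b p) (r +P scale a q)
      (solve 2 (λ a b → b :* a := con 0ℤ :+ a :* b) refl a b)
      (λ i → begin
        coeff (scale b p) i
          ≡⟨ coeff-scale b p i ⟩
        b ℤ.* coeff p i
          ≡⟨ solve 4 (λ a b p q → b :* p := (b :* p :+ (:- a) :* q) :+ a :* q) refl a b (coeff p i) (coeff q i) ⟩
        (b ℤ.* coeff p i ℤ.+ (ℤ.- a) ℤ.* coeff q i) ℤ.+ a ℤ.* coeff q i
          ≡⟨ cong₂ ℤ._+_ (coeff-r i) (coeff-scale a q i) ⟨
        coeff r i ℤ.+ coeff (scale a q) i
          ≡⟨ coeff-+P r (scale a q) i ⟨
        coeff (r +P scale a q) i ∎)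
      where open ≡.≡-Reasoning

-- The recursion runs on the bound `n`, because the polynomial `r` of a step is not a sublist of the
-- input.
bézout : ∀ n p q → length p ℕ.+ length q ℕ.≤ n → WeakBézout p q
bézout n       p       []      _ = WeakBézout-0ʳ p (λ i → refl)
bézout n       []      (b ∷ q) _ = WeakBézout-sym (WeakBézout-0ʳ (b ∷ q) (λ i → refl))
bézout (suc n) (a ∷ p) (b ∷ q) (ℕ.s≤s len) with ℕP.≤-total (length q) (length p)
... | inj₁ q≤p = bézout-step n (bézout n) a p b q q≤p len
... | inj₂ p≤q = WeakBézout-sym (bézout-step n (bézout n) b q a p p≤q
  (subst (ℕ._≤ n) (trans (ℕP.+-comm (length p) (suc (length q))) (sym (ℕP.+-suc (length q) (length p)))) len))

euclid : ∀ p q r → Coprime p q → p ∣P q *P r → p ∣P r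
euclid p q r = coprime-∣* {p} {q} {r} (bézout _ p q ℕP.≤-refl)

-- 2-adic valuations

-- After division by `2 ^ k` the number `c` becomes odd, so by Euclid's lemma the remaining factor 2
-- comes from `t`.
2∣cofactor : ∀ k {c} t → 2 ℕ.^ k ℕD.∣ c → ¬ 2 ℕ.^ suc k ℕD.∣ c → 2 ℕ.^ suc k ℕD.∣ t ℕ.* c → 2 ℕD.∣ t
2∣cofactor k t (divides q refl) ¬2^∣c 2^∣tc
  with euclidsLemma t q prime[2]
         (ℕD.*-cancelʳ-∣ (2 ℕ.^ k) {{ℕP.m^n≢0 2 k}} (subst (2 ℕ.^ suc k ℕD.∣_) (sym (ℕP.*-assoc t q (2 ℕ.^ k))) 2^∣tc))
... | inj₁ 2∣t = 2∣t
... | inj₂ 2∣q = ⊥-elim (¬2^∣c (ℕD.*-monoˡ-∣ (2 ℕ.^ k) 2∣q))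

^-monoʳ-∣ : ∀ b {k l} → k ≤ l → b ℕ.^ k ℕD.∣ b ℕ.^ l
^-monoʳ-∣ b {l = l} ℕ.z≤n       = ℕD.1∣ (b ℕ.^ l)
^-monoʳ-∣ b         (ℕ.s≤s k≤l) = ℕD.*-monoʳ-∣ b (^-monoʳ-∣ b k≤l)

even⊎odd : ∀ t → 2 ℕD.∣ t ⊎ ∃ λ s → t ≡ suc (s ℕ.* 2)
even⊎odd zero    = inj₁ (2 ℕD.∣0)
even⊎odd (suc t) with even⊎odd t
... | inj₁ (divides s refl) = inj₂ (s , refl)
... | inj₂ (s , refl)       = inj₁ (divides (suc s) refl)

module _ {m n k l} (m-E₂ : IsE2 m k) (n-E₂ : IsE2 n l) where

  -- Here `gcd m n` has valuation `l` while `2 ^ suc l` divides `m`, so the cofactor of the gcd in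
  -- `m` is even.
  2gcd∣m : k > l → 2 ℕ.* gcd m n ℕD.∣ m
  2gcd∣m l<k with ℕG.gcd[m,n]∣m m n
  ... | divides u m≡ = subst (2 ℕ.* gcd m n ℕD.∣_) (sym m≡)
    (ℕD.*-monoˡ-∣ (gcd m n) (2∣cofactor l u
      (ℕG.gcd-greatest (ℕD.∣-trans (^-monoʳ-∣ 2 (ℕP.<⇒≤ l<k)) (proj₁ m-E₂)) (proj₁ n-E₂))
      (λ 2^∣r → proj₂ n-E₂ (ℕD.∣-trans 2^∣r (ℕG.gcd[m,n]∣n m n)))
      (subst (2 ℕ.^ suc l ℕD.∣_) m≡ (ℕD.∣-trans (^-monoʳ-∣ 2 l<k) (proj₁ m-E₂)))))

  n-odd-multiple : k > l → ∃ λ s → n ≡ gcd m n ℕ.+ s ℕ.* (2 ℕ.* gcd m n)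
  n-odd-multiple l<k with ℕG.gcd[m,n]∣n m n
  ... | divides t n≡ with even⊎odd t
  ...   | inj₂ (s , refl) = s , trans n≡ (cong (gcd m n ℕ.+_) (ℕP.*-assoc s 2 (gcd m n)))
  -- An even cofactor, together with `2 ^ l` in the gcd, would put `2 ^ suc l` into `n`.
  ...   | inj₁ 2∣t = ⊥-elim (proj₂ n-E₂ (subst (2 ℕ.^ suc l ℕD.∣_) (sym n≡)
    (ℕD.*-pres-∣ 2∣t
      (ℕG.gcd-greatest (ℕD.∣-trans (^-monoʳ-∣ 2 (ℕP.<⇒≤ l<k)) (proj₁ m-E₂)) (proj₁ n-E₂)))))

  -- The valuation of `gcd m (2 * n)` is `k`, but `2 ^ suc k` divides `2 * n`. So the cofactor is
  -- even, and a factor 2 cancels.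
  gcd[m,2n]∣n : k ≤ l → gcd m (2 ℕ.* n) ℕD.∣ n
  gcd[m,2n]∣n k≤l with ℕG.gcd[m,n]∣n m (2 ℕ.* n)
  ... | divides t 2n≡ = ℕD.*-cancelˡ-∣ 2 (subst (2 ℕ.* gcd m (2 ℕ.* n) ℕD.∣_) (sym 2n≡)
    (ℕD.*-monoˡ-∣ (gcd m (2 ℕ.* n)) (2∣cofactor k t
      (ℕG.gcd-greatest (proj₁ m-E₂) (ℕD.∣n⇒∣m*n 2 2^k∣n))
      (λ 2^∣c → proj₂ m-E₂ (ℕD.∣-trans 2^∣c (ℕG.gcd[m,n]∣m m (2 ℕ.* n))))
      (subst (2 ℕ.^ suc k ℕD.∣_) 2n≡ (ℕD.*-monoʳ-∣ 2 2^k∣n)))))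
    where
    2^k∣n : 2 ℕ.^ k ℕD.∣ n
    2^k∣n = ℕD.∣-trans (^-monoʳ-∣ 2 k≤l) (proj₁ n-E₂)

-- Lucas-type sequences

∣p0∣∈1,2⇒∣2 : ∀ p0 → ℤ.∣ p0 ∣ ≡ 1 ⊎ ℤ.∣ p0 ∣ ≡ 2 → ∃ λ α → α ℤ.* p0 ≡ + 2
∣p0∣∈1,2⇒∣2 (+ _)    (inj₁ refl) = + 2 , refl
∣p0∣∈1,2⇒∣2 (+ _)    (inj₂ refl) = + 1 , refl
∣p0∣∈1,2⇒∣2 -[1+ _ ] (inj₁ refl) = -[1+ 1 ] , refl
∣p0∣∈1,2⇒∣2 -[1+ _ ] (inj₂ refl) = -[1+ 0 ] , refl

2p1≈p0d⇒αp1≈d : ∀ {α p0} p1 d → ¬ p0 ≡ 0ℤ → α ℤ.* p0 ≡ + 2 → scale (+ 2) p1 ≈ scale p0 d → const α *P p1 ≈ d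
2p1≈p0d⇒αp1≈d {α} {p0} p1 d p0≢0 αp0≡2 2p1≈p0d i =
  trans (const-*P α p1 i) (trans (coeff-scale α p1 i)
    (ℤP.*-cancelˡ-≡ p0 (α ℤ.* coeff p1 i) (coeff d i) {{ℤ.≢-nonZero p0≢0}} (begin
      p0 ℤ.* (α ℤ.* coeff p1 i)   ≡⟨ ℤP.*-assoc p0 α (coeff p1 i) ⟨
      p0 ℤ.* α ℤ.* coeff p1 i     ≡⟨ cong (ℤ._* coeff p1 i) (trans (ℤP.*-comm p0 α) αp0≡2) ⟩
      + 2 ℤ.* coeff p1 i          ≡⟨ coeff-scale (+ 2) p1 i ⟨
      coeff (scale (+ 2) p1) i    ≡⟨ 2p1≈p0d i ⟩
      coeff (scale p0 d) i        ≡⟨ coeff-scale p0 d i ⟩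
      p0 ℤ.* coeff d i            ∎)))
  where open ≡.≡-Reasoning

theorem18 : (p0 : ℤ) (p1 d g : Poly) →
    GFPParams d g → LucasType p0 p1 d g →
    (m n : ℕ) → 0 < m → 0 < n →
    (k l : ℕ) → IsE2 m k → IsE2 n l →
    ((k > l) → IsGCD (LucasSeq p0 p1 d g (gcd m n)) (FibSeq d g m) (LucasSeq p0 p1 d g n))
    × ((k ≤ l) → ∀ h → IsGCD h (LucasSeq p0 p1 d g (gcd m n)) (LucasSeq p0 p1 d g 0) →
    IsGCD h (FibSeq d g m) (LucasSeq p0 p1 d g n))
theorem18 p0 p1 d g (_ , _ , (_ , _ , d⊥g) , _) (_ , p0≢0 , 2p1≈p0d , ∣p0∣ , (_ , _ , p0⊥p1) , _)
          m n _ _ k l m-E₂ n-E₂ =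
    (λ l<k → let (s , n≡) = n-odd-multiple m-E₂ n-E₂ l<k
             in gcd-F-L-even L-rec {const α} αL₀≈2 αL₁≈d m n s (2gcd∣m m-E₂ n-E₂ l<k) n≡)
  -- `L 0` and `L 1` are `const p0` and `p1`, whose coprimality is part of being of Lucas type.
  , (λ k≤l → gcd-F-L-odd L-rec {const α} αL₀≈2 αL₁≈d m n (gcd[m,2n]∣n m-E₂ n-E₂ k≤l) p0⊥p1)
  where
  -- `FibSeq d g 0` is the list with the single entry `0ℤ`, equal to the empty list only
  -- coefficientwise.
  F₀≈0 : FibSeq d g 0 ≈ 0P
  F₀≈0 zero    = refl
  F₀≈0 (suc i) = refl
  open SecondOrderRecurrence.Fibonacci ℤ[X] euclid d g d⊥g (FibSeq d g) F₀≈0 (λ i → refl) (λ n i → refl)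
  L-rec : Recurrence (LucasSeq p0 p1 d g)
  L-rec n i = refl
  α : ℤ
  α = proj₁ (∣p0∣∈1,2⇒∣2 p0 ∣p0∣)
  αL₀≈2 : const α *P const p0 ≈ 1P +P 1P
  αL₀≈2 = ∷-cong [] [] (trans (ℤP.+-identityʳ (α ℤ.* p0)) (proj₂ (∣p0∣∈1,2⇒∣2 p0 ∣p0∣))) (λ i → refl)
  αL₁≈d : const α *P p1 ≈ d
  αL₁≈d = 2p1≈p0d⇒αp1≈d p1 d p0≢0 (proj₂ (∣p0∣∈1,2⇒∣2 p0 ∣p0∣)) 2p1≈p0d
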